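{- There is a function $f:\mathbb{N}\to\mathbb{R}$ with $f(w)\to 0$ as $w\to\infty$ such that for every positive integer $w$ and every integer $d\ge 2$, \[ \mathrm{olw}(w,d)\;\ge\;(2-f(w))\binom{w+1}{2}. \] In words: no on-line chain partitioning algorithm partitions every $2$-dimensional poset of width at most $w$ into fewer than $(2-o(1))\binom{w+1}{2}$ chains.
   Context: On-line chain partitioning is a game between two players, Anna and Bertha. In each round Anna introduces a new point and describes the poset induced on all points introduced so far (this poset extends the previously described one). Bertha then irrevocably assigns the new point to a chain, equivalently gives it a color, so that each color class is a chain of the final poset. An on-line chain partitioning algorithm is a strategy for Bertha. For positive integers $w,d$, $\mathrm{olw}(w,d)$ is the largest integer $k$ such that Anna has a strategy forcing every on-line chain partitioning algorithm to use at least $k$ chains, while the poset Anna constructs has width at most $w$ and dimension at most $d$. The dimension of a poset is the least size of a realizer, i.e. of a family of linear extensions whose intersection is the poset. -}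

module Defs where

open import Data.Nat using (ℕ; zero; suc; _≤_)
open import Data.Fin using (Fin; zero; suc)
open import Data.Bool using (Bool; T)
open import Data.Product using (Σ; _×_)
open import Data.Sum using (_⊎_)
open import Data.Integer using (+_)
open import Data.Rational using (ℚ; _/_)
open import Relation.Binary.PropositionalEquality using (_≡_; _≢_)
open import Relation.Nullary using (¬_)

BRel : ℕ → Set
BRel n = Fin n → Fin n → Bool

record IsPoset {n : ℕ} (P : BRel n) : Set where
  field
    reflexive : ∀ x → T (P x x)
    antisym   : ∀ x y → T (P x y) → T (P y x) → x ≡ y
    transitive : ∀ x y z → T (P x y) → T (P y z) → T (P x z)

Comparable : {n : ℕ} → BRel n → Fin n → Fin n → Set
Comparable P x y = T (P x y) ⊎ T (P y x)

record IsLinearExtension {n : ℕ} (P L : BRel n) : Set where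
  field
    isPoset : IsPoset L
    total   : ∀ x y → Comparable L x y
    extends : ∀ x y → T (P x y) → T (L x y)

-- Antichain of size m: m pairwise incomparable (hence distinct) points.
IsAntichain : {n m : ℕ} → BRel n → (Fin m → Fin n) → Set
IsAntichain P a = ∀ i j → i ≢ j → ¬ Comparable P (a i) (a j)

WidthAtMost : {n : ℕ} → BRel n → ℕ → Set
WidthAtMost {n} P w = ∀ m (a : Fin m → Fin n) → IsAntichain P a → m ≤ w

-- dimension ≤ d : P has a realizer consisting of (at most) d linear extensions
-- (a family of d linear extensions, repetitions allowed, whose intersection is P).
DimAtMost : {n : ℕ} → BRel n → ℕ → Set
DimAtMost {n} P d =
  Σ (Fin d → BRel n) λ L →
    (∀ k → IsLinearExtension P (L k)) ×
    (∀ x y → (∀ k → T (L k x y)) → T (P x y))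

UsesAtLeast : {n : ℕ} → (Fin n → ℕ) → ℕ → Set
UsesAtLeast {n} col k = Σ (Fin k → Fin n) λ g → ∀ i j → col (g i) ≡ col (g j) → i ≡ j

-- New point is `zero`; old point x becomes `suc x`.
extendCol : {n : ℕ} → ℕ → (Fin n → ℕ) → Fin (suc n) → ℕ
extendCol c col zero    = c
extendCol c col (suc x) = col x

-- AnnaWins w d k n P col : from the current position (poset P on n points,
-- Bertha's coloring col), Anna has a strategy forcing Bertha to use at least
-- k colors, keeping every presented poset of width ≤ w and dimension ≤ d.
-- Either k colors are already used, or Anna presents a new point (a poset on
-- n+1 points extending P) such that whatever legal color Bertha gives it
-- (its color class stays a chain), Anna still wins.
data AnnaWins (w d k : ℕ) : (n : ℕ) → BRel n → (Fin n → ℕ) → Set where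
  done : ∀ {n P col} → UsesAtLeast col k → AnnaWins w d k n P col
  move : ∀ {n P col} (P′ : BRel (suc n)) →
         IsPoset P′ →
         (∀ x y → P′ (suc x) (suc y) ≡ P x y) →
         WidthAtMost P′ w →
         DimAtMost P′ d →
         (∀ (c : ℕ) → (∀ x → col x ≡ c → Comparable P′ zero (suc x)) →
            AnnaWins w d k (suc n) P′ (extendCol c col)) →
         AnnaWins w d k n P col

-- Anna can force every on-line chain partitioning algorithm to use ≥ k chains
-- on posets of width ≤ w and dimension ≤ d;  i.e. olw(w,d) ≥ k.
AnnaForces : ℕ → ℕ → ℕ → Set
AnnaForces w d k = AnnaWins w d k 0 (λ ()) (λ ())

ℕtoℚ : ℕ → ℚ
ℕtoℚ n = + n / 1

{-# OPTIONS --safe #-}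

-- A place of the current poset P is a virtual extra point; Anna can play a whole game of smaller width
-- there, and a colour on a point of P incomparable to the place is blocked in that game. It therefore
-- suffices to reach, in width m + 1, a place with room for width m where 2(m + 1) - O(√m) colours are
-- blocked, and to repeat there.
--
-- Climbing: in width m + 1 Anna forces a place with room for width m, incomparable to a chain with m + 1
-- colours and above everything else. Climb in width m, climb again in the resulting place, and add a
-- point x above everything. The two chains have disjoint colours, so the colour of x is missing from one
-- of them; x extends that chain, and the next place is above the other one.
--
-- Now climb upside down, with colour set B on the incomparable chain, and below that build chains by
-- nested climbs of widths m + 1, m, m - 1, ... . Their colour sets are disjoint, so one of the first √m
-- of them meets B in at most about √m colours. The next place is put between the two parts, incomparable
-- only to this chain and to the one coloured B.
--
-- A place stays realizable in dimension two because it is always last in one of the two linear orders of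
-- the part below it; reflecting that part chooses the order in which it is last.
module Submission where

open import Defs
open import Data.Bool using (Bool; true; false; T; not; _∧_; _∨_)
open import Data.Bool.Properties using (T-∧; ∧-comm; ∧-zeroʳ; ∧-identityʳ; ∨-identityʳ; not-involutive)
open import Data.Empty using (⊥-elim)
open import Data.Fin using (Fin; zero; suc; join; splitAt; _↑ˡ_; _↑ʳ_; inject₁; punchOut)
open import Data.Fin.Properties using (suc-injective; splitAt-↑ˡ; splitAt-↑ʳ; join-splitAt; inject₁-injective; punchOut-injective; injective⇒≤; any?) renaming (_≟_ to _≟F_)
open import Data.Nat using (ℕ; zero; suc; _≤_; _<_; _+_; _∸_; _≤?_; _<?_; z≤n; s≤s) renaming (_*_ to _*ℕ_)
open import Data.Nat.Properties using (_≟_; ≤-refl; ≤-trans; ≤-reflexive; <⇒≤; <⇒≱; ≰⇒>; ≮⇒≥; n≤1+n; n<1+n; m≤n*m; +-suc; +-comm; +-assoc; +-identityʳ; *-identityʳ; *-distribˡ-+; +-mono-≤; +-monoˡ-≤; +-monoʳ-≤; +-cancelʳ-≤; *-mono-≤; *-monoˡ-≤; *-monoʳ-≤; *-mono-<; m+[n∸m]≡n; m≤n⇒m∸n≡0; m≤n+m∸n; module ≤-Reasoning)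
open import Data.Nat.Tactic.RingSolver using (solve-∀)
import Data.Integer as ℤ
import Data.Integer.Properties as ℤ
open import Data.Integer.Tactic.RingSolver using () renaming (solve-∀ to ℤ-solve-∀)
open import Data.Nat.Combinatorics using (_C_; nC1≡n; nCk+nC[k+1]≡[n+1]C[k+1])
open import Data.Product using (Σ; _×_; _,_; proj₁; proj₂)
open import Data.Rational using (ℚ; mkℚ; 0ℚ; ∣_∣; _-_; _*_; _/_; toℚᵘ; positive) renaming (_≤_ to _≤ℚ_; _<_ to _<ℚ_)
open import Data.Rational.Properties using (toℚᵘ-cancel-≤; toℚᵘ-fromℚᵘ; toℚᵘ-homo-*; toℚᵘ-homo-+; toℚᵘ-homo‿-; 0≤p⇒∣p∣≡p; nonNegative⁻¹; normalize-nonNeg)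
open import Data.Rational.Unnormalised using (mkℚᵘ; _≃_; *≤*)
import Data.Rational as ℚ using (-_)
import Data.Rational.Unnormalised as ℚᵘ
import Data.Rational.Unnormalised.Properties as ℚᵘ
open import Data.Unit using (⊤)
open import Data.Sum using (_⊎_; inj₁; inj₂; map; swap) renaming ([_,_]′ to [_,_])
open import Function using (_∘_; _on_; id; const; flip)
open import Function.Bundles using (Equivalence)
open import Relation.Binary.PropositionalEquality using (_≡_; _≢_; refl; sym; trans; cong; cong₂; subst)
open import Relation.Nullary using (¬_; Dec; yes; no)

-- Realizers, chain covers and insertion into a place

Relᵇ : Set → Set
Relᵇ A = A → A → Bool

T-not : ∀ {b} → ¬ T b → T (not b)
T-not {false} _ = _
T-not {true} f = ⊥-elim (f _)

T-not⁻¹ : ∀ {b} → T (not b) → ¬ T b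
T-not⁻¹ {false} _ ()

record Linear {A : Set} (L : Relᵇ A) : Set where
  field
    compare : ∀ a b → T (L a b) ⊎ T (L b a)
    antisymmetric : ∀ a b → T (L a b) → T (L b a) → a ≡ b
    transitive : ∀ a b c → T (L a b) → T (L b c) → T (L a c)

open Linear

record Realizer {A : Set} (P : Relᵇ A) : Set where
  field
    LX LY : Relᵇ A
    linearX : Linear LX
    linearY : Linear LY
    meet : ∀ a b → P a b ≡ LX a b ∧ LY a b

open Realizer

Comp : {A : Set} → Relᵇ A → A → A → Set
Comp P a b = T (P a b) ⊎ T (P b a)

Cover : {A : Set} → Relᵇ A → {w : ℕ} → (A → Fin w) → Set
Cover P κ = ∀ a b → κ a ≡ κ b → Comp P a b

Good : {A : Set} → ℕ → Relᵇ A → Set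
Good {A} w P = Realizer P × Σ (A → Fin w) (Cover P)

-- The predecessors of a point that could be added to L: β a holds iff a would lie below it.
Cut : {A : Set} → Relᵇ A → (A → Bool) → Set
Cut L β = ∀ a b → T (L a b) → T (β b) → T (β a)

-- The points of B are put into one place of P: lo and hi select the points of A below, respectively
-- above, all of B.
insert : {A B : Set} → Relᵇ A → Relᵇ B → (A → Bool) → (A → Bool) → Relᵇ (B ⊎ A)
insert P Q lo hi (inj₁ b) (inj₁ b′) = Q b b′
insert P Q lo hi (inj₁ b) (inj₂ a) = hi a
insert P Q lo hi (inj₂ a) (inj₁ b) = lo a
insert P Q lo hi (inj₂ a) (inj₂ a′) = P a a′

none all : {A : Set} → A → Bool
none _ = false
all _ = true

module _ {A B : Set} where

  -- `Cut` makes `β` an initial segment of `L`, so `M` fits as a block between it and the rest.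
  insert-linear : {L : Relᵇ A} {M : Relᵇ B} {β : A → Bool} → Linear L → Linear M → Cut L β →
    Linear (insert L M β (not ∘ β))
  insert-linear {L} {M} {β} l m cut = record { compare = cmp ; antisymmetric = asym ; transitive = tr }
    where
    I : Relᵇ (B ⊎ A)
    I = insert L M β (not ∘ β)
    cmp : ∀ a b → T (I a b) ⊎ T (I b a)
    cmp (inj₁ b) (inj₁ b′) = compare m b b′
    cmp (inj₁ b) (inj₂ a) with β a
    ... | true = inj₂ _
    ... | false = inj₁ _
    cmp (inj₂ a) (inj₁ b) with β a
    ... | true = inj₁ _
    ... | false = inj₂ _
    cmp (inj₂ a) (inj₂ a′) = compare l a a′
    asym : ∀ a b → T (I a b) → T (I b a) → a ≡ b
    asym (inj₁ b) (inj₁ b′) p q = cong inj₁ (antisymmetric m b b′ p q)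
    asym (inj₁ b) (inj₂ a) p q = ⊥-elim (T-not⁻¹ p q)
    asym (inj₂ a) (inj₁ b) p q = ⊥-elim (T-not⁻¹ q p)
    asym (inj₂ a) (inj₂ a′) p q = cong inj₂ (antisymmetric l a a′ p q)
    tr : ∀ a b c → T (I a b) → T (I b c) → T (I a c)
    tr (inj₁ b) (inj₁ b′) (inj₁ b″) p q = transitive m b b′ b″ p q
    tr (inj₁ b) (inj₁ b′) (inj₂ a) p q = q
    tr (inj₁ b) (inj₂ a) (inj₁ b′) p q = ⊥-elim (T-not⁻¹ p q)
    tr (inj₁ b) (inj₂ a) (inj₂ a′) p q = T-not λ r → T-not⁻¹ p (cut a a′ q r)
    tr (inj₂ a) (inj₁ b) (inj₁ b′) p q = p
    tr (inj₂ a) (inj₁ b) (inj₂ a′) p q with compare l a a′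
    ... | inj₁ r = r
    ... | inj₂ r = ⊥-elim (T-not⁻¹ q (cut a′ a r p))
    tr (inj₂ a) (inj₂ a′) (inj₁ b) p q = cut a a′ p q
    tr (inj₂ a) (inj₂ a′) (inj₂ a″) p q = transitive l a a′ a″ p q

  insert-cut : {L : Relᵇ A} {M : Relᵇ B} {β : A → Bool} (δ : B ⊎ A → Bool) →
    Cut L (δ ∘ inj₂) → Cut M (δ ∘ inj₁) →
    (∀ a b → T (β a) → T (δ (inj₁ b)) → T (δ (inj₂ a))) →
    (∀ a b → ¬ T (β a) → T (δ (inj₂ a)) → T (δ (inj₁ b))) →
    Cut (insert L M β (not ∘ β)) δ
  insert-cut δ cl cm f g (inj₁ b) (inj₁ b′) p q = cm b b′ p q
  insert-cut δ cl cm f g (inj₁ b) (inj₂ a) p q = g a b (T-not⁻¹ p) q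
  insert-cut δ cl cm f g (inj₂ a) (inj₁ b) p q = f a b p q
  insert-cut δ cl cm f g (inj₂ a) (inj₂ a′) p q = cl a a′ p q

  -- A point of A is below the block if it lies in both cuts, above it if it lies in neither, and
  -- incomparable to it if it lies in exactly one.
  insert-realizer : {P : Relᵇ A} {Q : Relᵇ B} (ρ : Realizer P) (σ : Realizer Q) (βX βY : A → Bool) →
    Cut (LX ρ) βX → Cut (LY ρ) βY → {lo hi : A → Bool} →
    (∀ a → lo a ≡ βX a ∧ βY a) → (∀ a → hi a ≡ not (βX a) ∧ not (βY a)) →
    Realizer (insert P Q lo hi)
  insert-realizer {P} {Q} ρ σ βX βY cX cY {lo} {hi} elo ehi = record
    { LX = insert (LX ρ) (LX σ) βX (not ∘ βX)
    ; LY = insert (LY ρ) (LY σ) βY (not ∘ βY)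
    ; linearX = insert-linear (linearX ρ) (linearX σ) cX
    ; linearY = insert-linear (linearY ρ) (linearY σ) cY
    ; meet = eq }
    where
    eq : ∀ a b → insert P Q lo hi a b ≡
      insert (LX ρ) (LX σ) βX (not ∘ βX) a b ∧ insert (LY ρ) (LY σ) βY (not ∘ βY) a b
    eq (inj₁ b) (inj₁ b′) = meet σ b b′
    eq (inj₁ b) (inj₂ a) = ehi a
    eq (inj₂ a) (inj₁ b) = elo a
    eq (inj₂ a) (inj₂ a′) = meet ρ a a′

  -- A chain of B may be merged with a chain of A as soon as the points of A on it are comparable to
  -- the place.
  insert-cover : {P : Relᵇ A} {Q : Relᵇ B} {lo hi : A → Bool} {w : ℕ} {κ : A → Fin w} {λ′ : B → Fin w} →
    Cover P κ → Cover Q λ′ → (∀ a b → κ a ≡ λ′ b → T (lo a) ⊎ T (hi a)) →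
    Cover (insert P Q lo hi) [ λ′ , κ ]
  insert-cover c d x (inj₁ b) (inj₁ b′) e = d b b′ e
  insert-cover c d x (inj₁ b) (inj₂ a) e = swap (x a b (sym e))
  insert-cover c d x (inj₂ a) (inj₁ b) e = x a b e
  insert-cover c d x (inj₂ a) (inj₂ a′) e = c a a′ e

swapᴿ : {A : Set} {P : Relᵇ A} → Realizer P → Realizer P
swapᴿ ρ = record { LX = LY ρ ; LY = LX ρ ; linearX = linearY ρ ; linearY = linearX ρ
                 ; meet = λ a b → trans (meet ρ a b) (∧-comm (LX ρ a b) (LY ρ a b)) }

flip-linear : {A : Set} {L : Relᵇ A} → Linear L → Linear (flip L)
flip-linear l = record { compare = λ a b → compare l b a
                       ; antisymmetric = λ a b p q → antisymmetric l a b q p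
                       ; transitive = λ a b c p q → transitive l c b a q p }

flipᴿ : {A : Set} {P : Relᵇ A} → Realizer P → Realizer (flip P)
flipᴿ ρ = record { LX = flip (LX ρ) ; LY = flip (LY ρ) ; linearX = flip-linear (linearX ρ)
                 ; linearY = flip-linear (linearY ρ) ; meet = λ a b → meet ρ b a }

pullback-realizer : {A B : Set} {P : Relᵇ A} {f : B → A} → (∀ {a b} → f a ≡ f b → a ≡ b) →
  Realizer P → Realizer (P on f)
pullback-realizer {f = f} inj ρ = record
  { LX = LX ρ on f ; LY = LY ρ on f ; linearX = lin (linearX ρ) ; linearY = lin (linearY ρ)
  ; meet = λ a b → meet ρ (f a) (f b) }
  where
  lin : ∀ {L} → Linear L → Linear (L on f)
  lin l = record { compare = λ a b → compare l (f a) (f b)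
                 ; antisymmetric = λ a b p q → inj (antisymmetric l (f a) (f b) p q)
                 ; transitive = λ a b c → transitive l (f a) (f b) (f c) }

splitAt-injective : ∀ q {n} {x y : Fin (q + n)} → splitAt q x ≡ splitAt q y → x ≡ y
splitAt-injective q {n} {x} {y} e =
  trans (sym (join-splitAt q n x)) (trans (cong (join q n) e) (join-splitAt q n y))

-- The new points come first, so the newest point of a game played in the place is `zero` in the
-- whole poset as well.
insertF : ∀ {q n} → BRel n → BRel q → (Fin n → Bool) → (Fin n → Bool) → BRel (q + n)
insertF {q} P Q lo hi = insert P Q lo hi on splitAt q

pullback-good : {A B : Set} {P : Relᵇ A} {f : B → A} {w : ℕ} → (∀ {a b} → f a ≡ f b → a ≡ b) →
  Good w P → Good w (P on f)
pullback-good {f = f} inj (ρ , κ , c) = pullback-realizer inj ρ , κ ∘ f , λ a b → c (f a) (f b)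

-- Strategies and their composition

Proper : ∀ {n} → BRel n → (Fin n → ℕ) → Set
Proper P col = ∀ x y → col x ≡ col y → Comp P x y

Goal : Set₁
Goal = ∀ {n} → BRel n → (Fin n → ℕ) → Set

-- The game of the theorem with an arbitrary goal; a realizer and a chain cover certify the bounds on
-- dimension and width.
data Force (w : ℕ) (R : Goal) : (n : ℕ) → BRel n → (Fin n → ℕ) → Set where
  done : ∀ {n P col} → R P col → Force w R n P col
  move : ∀ {n P col} (P′ : BRel (1 + n)) → (∀ x y → P′ (suc x) (suc y) ≡ P x y) → Good w P′ →
    (∀ col′ → (∀ x → col′ (suc x) ≡ col x) → Proper P′ col′ → Force w R (1 + n) P′ col′) →
    Force w R n P col

-- Sequential composition: `k` takes over where the first strategy reaches its goal.
bind : ∀ {w w′ n} {R R′ : Goal} {P : BRel n} {col} → (∀ {k} {Q : BRel k} → Good w Q → Good w′ Q) →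
  (∀ {k} {Q : BRel k} {c} → Proper Q c → R Q c → Force w′ R′ k Q c) →
  Proper P col → Force w R n P col → Force w′ R′ n P col
bind up k pr (done r) = k pr r
bind up k pr (move P′ ext good next) =
  move P′ ext (up good) λ col′ e pr′ → bind up k pr′ (next col′ e pr′)

-- Chains and legal colours do not depend on the direction of the order, so a strategy can be played
-- upside down.
dual : ∀ {w n} {R : Goal} {P : BRel n} {col} → Force w R n P col →
  Force w (λ Q → R (flip Q)) n (flip P) col
dual (done r) = done r
dual (move P′ ext (ρ , κ , c) next) =
  move (flip P′) (λ x y → ext y x) (flipᴿ ρ , κ , λ a b e → swap (c a b e))
    λ col′ e pr → dual (next col′ e λ x y q → swap (pr x y q))

record Agree {q n} (c : Fin (q + n) → ℕ) (colQ : Fin q → ℕ) (col : Fin n → ℕ) : Set where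
  constructor agree
  field
    new : ∀ l → c (l ↑ˡ n) ≡ colQ l
    old : ∀ p → c (q ↑ʳ p) ≡ col p

module _ {q n} {P : BRel n} {Q : BRel q} {lo hi : Fin n → Bool} where

  insertF-new : ∀ l l′ → insertF P Q lo hi (l ↑ˡ n) (l′ ↑ˡ n) ≡ Q l l′
  insertF-new l l′ rewrite splitAt-↑ˡ q l n | splitAt-↑ˡ q l′ n = refl

  insertF-lo : ∀ p l → insertF P Q lo hi (q ↑ʳ p) (l ↑ˡ n) ≡ lo p
  insertF-lo p l rewrite splitAt-↑ʳ q n p | splitAt-↑ˡ q l n = refl

  insertF-hi : ∀ p l → insertF P Q lo hi (l ↑ˡ n) (q ↑ʳ p) ≡ hi p
  insertF-hi p l rewrite splitAt-↑ʳ q n p | splitAt-↑ˡ q l n = refl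

  proper-new : ∀ {c} → Proper (insertF P Q lo hi) c → Proper Q (c ∘ (_↑ˡ n))
  proper-new pr l l′ e with pr _ _ e
  ... | inj₁ t = inj₁ (subst T (insertF-new l l′) t)
  ... | inj₂ t = inj₂ (subst T (insertF-new l′ l) t)

  incomparable-colours : ∀ {c} → Proper (insertF P Q lo hi) c → ∀ p → lo p ≡ false → hi p ≡ false →
    ∀ l → c (q ↑ʳ p) ≢ c (l ↑ˡ n)
  incomparable-colours pr p el eh l e with pr _ _ e
  ... | inj₁ t = subst T (trans (insertF-lo p l) el) t
  ... | inj₂ t = subst T (trans (insertF-hi p l) eh) t

-- A strategy for width m can be played inside any place of P with room for width m.
module _ {m w n} {R R′ : Goal} (P : BRel n) (col : Fin n → ℕ) (lo hi : Fin n → Bool)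
  (room : ∀ {q} {Q : BRel q} → Good m Q → Good w (insertF P Q lo hi))
  (continue : ∀ {q} {Q : BRel q} {colQ c} → R Q colQ → Agree c colQ col →
    Proper (insertF P Q lo hi) c → Force w R′ (q + n) (insertF P Q lo hi) c)
  where

  substitute : ∀ {q} {Q : BRel q} {colQ c} → Force m R q Q colQ → Agree c colQ col →
    Proper (insertF P Q lo hi) c → Force w R′ (q + n) (insertF P Q lo hi) c
  substitute (done r) ag pr = continue r ag pr
  substitute {q} {Q} (move Q′ ext good next) (agree agˡ agʳ) pr =
    move (insertF P Q′ lo hi) ext′ (room good) λ c e pr′ →
      substitute (next (c ∘ (_↑ˡ n)) (λ x → trans (e (x ↑ˡ n)) (agˡ x))
                    (proper-new {P = P} {Q = Q′} {lo} {hi} pr′))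
        (agree (λ _ → refl) λ p → trans (e (q ↑ʳ p)) (agʳ p)) pr′
    where
    ext′ : ∀ x y → insertF P Q′ lo hi (suc x) (suc y) ≡ insertF P Q lo hi x y
    ext′ x y with splitAt q x | splitAt q y
    ... | inj₁ l | inj₁ l′ = ext l l′
    ... | inj₁ _ | inj₂ _ = refl
    ... | inj₂ _ | inj₁ _ = refl
    ... | inj₂ _ | inj₂ _ = refl

  play : (∀ {P₀ : BRel 0} {col₀} → Force m R 0 P₀ col₀) → Proper P col → Force w R′ n P col
  play s pr = substitute {Q = λ ()} {colQ = λ ()} {c = col} s (agree (λ ()) λ _ → refl) pr

-- Slots and peaks

module _ {A B : Set} {P : Relᵇ A} {Q : Relᵇ B} (ρ : Realizer P) (β : A → Bool) (cut : Cut (LX ρ) β)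
  (σ : Realizer Q) where

  -- Q is put on top of Y; the two realizers differ in the coordinate of P that is used as X.
  nestˣ nestʸ : Realizer (insert P Q β none)
  nestˣ = insert-realizer ρ σ β all cut (λ _ _ _ _ → _)
    (λ a → sym (∧-identityʳ (β a))) (λ a → sym (∧-zeroʳ (not (β a))))
  nestʸ = insert-realizer (swapᴿ ρ) σ all β (λ _ _ _ _ → _) cut (λ _ → refl) (λ _ → refl)

-- A place above the points selected by β and incomparable to the others, on top of Y; the chains in the
-- image of ι avoid the incomparable points, so posets of width c can be inserted.
record Slot {A : Set} (w c : ℕ) (P : Relᵇ A) : Set where
  field
    realizer : Realizer P
    β : A → Bool
    cut : Cut (LX realizer) β
    κ : A → Fin w
    cover : Cover P κ
    ι : Fin c → Fin w
    ι-injective : ∀ {i j} → ι i ≡ ι j → i ≡ j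
    free : ∀ a k → κ a ≡ ι k → T (β a)

module _ {A B : Set} {w c : ℕ} {P : Relᵇ A} {Q : Relᵇ B} (S : Slot w c P) where
  open Slot S

  slot-cover : {κ′ : B → Fin c} → Cover Q κ′ → Cover (insert P Q β none) [ ι ∘ κ′ , κ ]
  slot-cover {κ′} cov = insert-cover cover (λ a b e → cov a b (ι-injective e)) λ a b e → inj₁ (free a (κ′ b) e)

  slot-room : Good c Q → Good w (insert P Q β none)
  slot-room (σ , κ′ , cov) = nestˣ realizer β cut σ , _ , slot-cover cov

isSuc : ∀ {m} → Fin m → Bool
isSuc zero = false
isSuc (suc _) = true

-- The chain numbered zero is the set of points incomparable to the slot.
record Peak {A : Set} (m : ℕ) (P : Relᵇ A) : Set where
  field
    realizer : Realizer P
    κ : A → Fin (1 + m)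
    cover : Cover P κ
    cut : Cut (LX realizer) (isSuc ∘ κ)

  inside : A → Bool
  inside = isSuc ∘ κ

-- Leaves the number 1 for a new chain, while chain zero stays the incomparable one.
widen : ∀ {m} → Fin (1 + m) → Fin (2 + m)
widen zero = zero
widen (suc k) = suc (suc k)

widen-injective : ∀ {m} {i j : Fin (1 + m)} → widen i ≡ widen j → i ≡ j
widen-injective {i = zero} {zero} _ = refl
widen-injective {i = suc _} {suc _} refl = refl

isSuc-widen : ∀ {m} (k : Fin (1 + m)) → isSuc (widen k) ≡ isSuc k
isSuc-widen zero = refl
isSuc-widen (suc _) = refl

cut-cong : {A : Set} {L : Relᵇ A} {β γ : A → Bool} → (∀ a → γ a ≡ β a) → Cut L β → Cut L γ
cut-cong e c a b p q = subst T (sym (e a)) (c a b p (subst T (e b) q))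

peak-good : {A : Set} {m : ℕ} {P : Relᵇ A} → Peak m P → Good (1 + m) P
peak-good K = Peak.realizer K , Peak.κ K , Peak.cover K

module _ {A : Set} {m : ℕ} {P : Relᵇ A} (K : Peak m P) where
  open Peak K

  peak-slot : Slot (2 + m) (1 + m) P
  peak-slot = record
    { realizer = realizer ; β = inside ; cut = cut ; κ = widen ∘ κ
    ; cover = λ a b e → cover a b (widen-injective e)
    ; ι = suc ; ι-injective = suc-injective ; free = λ a k e → free (κ a) k e }
    where
    free : ∀ (i : Fin (1 + m)) k → widen i ≡ suc k → T (isSuc i)
    free (suc _) _ _ = _

  module _ {B : Set} {Q : Relᵇ B} where

    -- The next slot comes after Q in both orders and stays incomparable to chain zero of P.
    keep-outer : Good (1 + m) Q → Peak (1 + m) (insert P Q inside none)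
    keep-outer (σ , κ′ , cov) = record
      { realizer = nestˣ realizer inside cut σ
      ; κ = [ suc ∘ κ′ , widen ∘ κ ]
      ; cover = slot-cover peak-slot cov
      ; cut = insert-cut _ (cut-cong (isSuc-widen ∘ κ) cut) (λ _ _ _ _ → _)
                (λ a _ p _ → subst T (sym (isSuc-widen (κ a))) p) (λ _ _ _ _ → _) }

    -- Here Q is on top in X, so a cut within Q leaves all of P below. The old chain zero becomes
    -- the ordinary chain 1, and chain zero of Q takes over its role.
    keep-inner : Peak m Q → Peak (1 + m) (insert P Q inside none)
    keep-inner K′ = record
      { realizer = nestʸ realizer inside cut (Peak.realizer K′)
      ; κ = [ widen ∘ Peak.κ K′ , suc ∘ κ ]
      ; cover = insert-cover (λ a b e → cover a b (suc-injective e))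
                  (λ a b e → Peak.cover K′ a b (widen-injective e)) (λ a b e → inj₁ (in-E (κ a) (Peak.κ K′ b) e))
      ; cut = insert-cut _ (λ _ _ _ _ → _) (cut-cong (isSuc-widen ∘ Peak.κ K′) (Peak.cut K′))
                (λ _ _ _ _ → _) (λ _ _ p _ → ⊥-elim (p _)) }
      where
      in-E : ∀ (i j : Fin (1 + m)) → suc i ≡ widen j → T (isSuc i)
      in-E (suc _) (suc _) _ = _
      in-E (suc _) zero ()
      in-E zero (suc _) ()
      in-E zero zero ()

point : BRel 1
point _ _ = true

point-peak : Peak 0 point
point-peak = record
  { realizer = record { LX = point ; LY = point ; linearX = lin ; linearY = lin ; meet = λ _ _ → refl }
  ; κ = id ; cover = λ _ _ _ → inj₁ _ ; cut = λ { zero zero _ t → t } }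
  where
  lin : Linear point
  lin = record { compare = λ _ _ → inj₁ _ ; antisymmetric = λ { zero zero _ _ → refl }
               ; transitive = λ _ _ _ _ _ → _ }

-- The top point joins chain zero and lies beyond the cut in X, so the next slot, last in Y, is
-- incomparable to it.
add-top : {A : Set} {m : ℕ} {P : Relᵇ A} → Peak m P → Peak m (insert P point all none)
add-top K = record
  { realizer = insert-realizer realizer (Peak.realizer point-peak) all all (λ _ _ _ _ → _) (λ _ _ _ _ → _)
                 (λ _ → refl) (λ _ → refl)
  ; κ = [ const zero , κ ]
  ; cover = insert-cover cover (λ _ _ _ → inj₁ _) (λ _ _ _ → inj₁ _)
  ; cut = insert-cut _ cut (λ _ _ _ ()) (λ _ _ _ ()) (λ _ _ p _ → p _) }
  where open Peak K

pullback-peak : {A B : Set} {m : ℕ} {P : Relᵇ A} {f : B → A} → (∀ {a b} → f a ≡ f b → a ≡ b) →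
  Peak m P → Peak m (P on f)
pullback-peak {f = f} inj K = record
  { realizer = pullback-realizer inj realizer ; κ = κ ∘ f ; cover = λ a b → cover (f a) (f b)
  ; cut = λ a b → cut (f a) (f b) }
  where open Peak K

good-suc : ∀ {w} {A : Set} {P : Relᵇ A} → Good w P → Good (1 + w) P
good-suc (ρ , κ , cov) = ρ , inject₁ ∘ κ , λ a b e → cov a b (inject₁-injective e)

-- Blocked colours

-- Points incomparable to a place, with different colours satisfying Φ; these colours cannot be used there.
record Outside {n : ℕ} (β : Fin n → Bool) (col : Fin n → ℕ) (Φ : ℕ → Set) (k : ℕ) : Set where
  field
    pt : Fin k → Fin n
    out : ∀ i → β (pt i) ≡ false
    distinct : ∀ {i j} → col (pt i) ≡ col (pt j) → i ≡ j
    colour : ∀ i → Φ (col (pt i))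

AnyColour : ℕ → Set
AnyColour _ = ⊤

module _ {n k : ℕ} {β : Fin n → Bool} {col : Fin n → ℕ} {Φ : ℕ → Set} (O : Outside β col Φ k) where
  open Outside O

  outside-cong : {γ : Fin n → Bool} → (∀ a → γ a ≡ β a) → Outside γ col Φ k
  outside-cong e = record { pt = pt ; out = λ i → trans (e (pt i)) (out i) ; distinct = distinct ; colour = colour }

  outside-anyColour : Outside β col AnyColour k
  outside-anyColour = record { pt = pt ; out = out ; distinct = distinct ; colour = _ }

  outside-sub : ∀ {l} {Ψ : ℕ → Set} (f : Fin l → Fin k) → (∀ {i j} → f i ≡ f j → i ≡ j) →
    (∀ i → Ψ (col (pt (f i)))) → Outside β col Ψ l
  outside-sub f inj ψ = record { pt = pt ∘ f ; out = out ∘ f ; distinct = inj ∘ distinct ; colour = ψ }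

++-distinct : ∀ {X : Set} {k l} {f : Fin k → X} {g : Fin l → X} → (∀ {i j} → f i ≡ f j → i ≡ j) →
  (∀ {i j} → g i ≡ g j → i ≡ j) → (∀ i j → f i ≢ g j) →
  ∀ {i j} → [ f , g ] (splitAt k i) ≡ [ f , g ] (splitAt k j) → i ≡ j
++-distinct {k = k} {l} {f} {g} injf injg disj {i} {j} e = splitAt-injective k (cases (splitAt k i) (splitAt k j) e)
  where
  cases : ∀ x y → [ f , g ] x ≡ [ f , g ] y → x ≡ y
  cases (inj₁ x) (inj₁ y) q = cong inj₁ (injf q)
  cases (inj₁ x) (inj₂ y) q = ⊥-elim (disj x y q)
  cases (inj₂ x) (inj₁ y) q = ⊥-elim (disj y x (sym q))
  cases (inj₂ x) (inj₂ y) q = cong inj₂ (injg q)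

outside-++ : ∀ {n k l β col Φ} (O : Outside {n} β col Φ k) (O′ : Outside β col Φ l) →
  (∀ i j → col (Outside.pt O i) ≢ col (Outside.pt O′ j)) → Outside β col Φ (k + l)
outside-++ {n} {k} {l} {β} {col} {Φ} O O′ disj = record
  { pt = pts ∘ splitAt k
  ; out = outs ∘ splitAt k
  ; distinct = λ {i} {j} e → ++-distinct {f = col ∘ Outside.pt O} {g = col ∘ Outside.pt O′}
      (Outside.distinct O) (Outside.distinct O′) disj
      (trans (sym (col-pts (splitAt k i))) (trans e (col-pts (splitAt k j))))
  ; colour = colours ∘ splitAt k }
  where
  pts : Fin k ⊎ Fin l → Fin n
  pts = [ Outside.pt O , Outside.pt O′ ]
  outs : ∀ x → β (pts x) ≡ false
  outs (inj₁ x) = Outside.out O x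
  outs (inj₂ y) = Outside.out O′ y
  colours : ∀ x → Φ (col (pts x))
  colours (inj₁ x) = Outside.colour O x
  colours (inj₂ y) = Outside.colour O′ y
  col-pts : ∀ x → col (pts x) ≡ [ col ∘ Outside.pt O , col ∘ Outside.pt O′ ] x
  col-pts (inj₁ x) = refl
  col-pts (inj₂ y) = refl

module _ {q n k : ℕ} {colQ : Fin q → ℕ} {col : Fin n → ℕ} {c : Fin (q + n) → ℕ} (ag : Agree c colQ col)
  (δ : Fin q ⊎ Fin n → Bool) {Φ : ℕ → Set} where
  open Agree ag

  outside-old : Outside (δ ∘ inj₂) col Φ k → Outside (δ ∘ splitAt q) c Φ k
  outside-old O = record
    { pt = (q ↑ʳ_) ∘ pt
    ; out = λ i → trans (cong δ (splitAt-↑ʳ q n (pt i))) (out i)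
    ; distinct = λ e → distinct (trans (sym (old _)) (trans e (old _)))
    ; colour = λ i → subst Φ (sym (old _)) (colour i) }
    where open Outside O

  outside-new : Outside (δ ∘ inj₁) colQ Φ k → Outside (δ ∘ splitAt q) c Φ k
  outside-new O = record
    { pt = (_↑ˡ n) ∘ pt
    ; out = λ i → trans (cong δ (splitAt-↑ˡ q (pt i) n)) (out i)
    ; distinct = λ e → distinct (trans (sym (new _)) (trans e (new _)))
    ; colour = λ i → subst Φ (sym (new _)) (colour i) }
    where open Outside O

-- Climbing

Climbed : ℕ → Goal
Climbed m P col = Σ (Peak m P) λ K → Outside (Peak.inside K) col AnyColour (1 + m)

module _ {n m} {P : BRel n} (K : Peak m P) where

  add-topF : Peak m (insertF {1} P point all none)
  add-topF = pullback-peak (splitAt-injective 1) (add-top K)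

  outside-top : ∀ {k} col c → (∀ x → c (suc x) ≡ col x) → (O : Outside (Peak.inside K) col AnyColour k) →
    (∀ i → c zero ≢ col (Outside.pt O i)) → Outside (Peak.inside add-topF) c AnyColour (1 + k)
  outside-top {k} col c e O new = record
    { pt = pt′ ; out = λ { zero → refl ; (suc i) → out i } ; distinct = distinct′ ; colour = _ }
    where
    open Outside O
    pt′ : Fin (1 + k) → Fin (1 + n)
    pt′ zero = zero
    pt′ (suc i) = suc (pt i)
    distinct′ : ∀ {i j} → c (pt′ i) ≡ c (pt′ j) → i ≡ j
    distinct′ {zero} {zero} _ = refl
    distinct′ {zero} {suc j} q = ⊥-elim (new j (trans q (e _)))
    distinct′ {suc i} {zero} q = ⊥-elim (new i (trans (sym q) (e _)))
    distinct′ {suc i} {suc j} q = cong suc (distinct (trans (sym (e _)) (trans q (e _))))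

climb : ∀ m {P : BRel 0} {col} → Force (1 + m) (Climbed m) 0 P col
climb zero = move point (λ ()) (peak-good point-peak) λ _ _ _ → done (point-peak , record
  { pt = id ; out = λ { zero → refl } ; distinct = λ { {zero} {zero} _ → refl } ; colour = _ })
climb (suc m) = bind good-suc lower (λ ()) (climb m)
  where
  lower : ∀ {n} {P : BRel n} {col} → Proper P col → Climbed m P col → Force (2 + m) (Climbed (1 + m)) n P col
  -- With `2 + m` chains allowed, the empty chain 1 joins the m chains below the slot, so the second
  -- climb also has width `1 + m`.
  lower {n} {P} {col} pr (K , O) = play P col inside none
    (pullback-good (splitAt-injective _) ∘ slot-room (peak-slot K)) upper (climb m) pr
    where
    open Peak K using (inside; κ)
    upper : ∀ {q} {Q : BRel q} {colQ c} → Climbed m Q colQ → Agree c colQ col →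
      Proper (insertF P Q inside none) c →
      Force (2 + m) (Climbed (1 + m)) (q + n) (insertF P Q inside none) c
    -- Both peaks live on the same poset, so the top point can be presented before its colour
    -- decides between them.
    upper {q} {Q} {colQ} {c} (K′ , O′) ag pr = move _ (λ _ _ → refl) (peak-good (add-topF outer)) last
      where
      open Agree ag
      outer inner : Peak (1 + m) (insertF P Q inside none)
      outer = pullback-peak (splitAt-injective q) (keep-outer K (peak-good K′))
      inner = pullback-peak (splitAt-injective q) (keep-inner K K′)
      last : ∀ c′ → (∀ x → c′ (suc x) ≡ c x) → Proper (insertF {1} (insertF P Q inside none) point all none) c′ →
        Force (2 + m) (Climbed (1 + m)) (1 + (q + n)) (insertF {1} (insertF P Q inside none) point all none) c′
      last c′ e pr′ with any? (λ i → c′ zero ≟ c (q ↑ʳ Outside.pt O i))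
      ... | no new = done (add-topF outer ,
        outside-top outer c c′ e (outside-old ag (isSuc ∘ [ _ , _ ]) (outside-cong O (isSuc-widen ∘ κ)))
          λ i r → new (i , r))
      -- The colour of the top point occurs on chain zero of `K`, which is incomparable to all of Q;
      -- hence it is new for chain zero of `K′`.
      ... | yes (i , r) = done (add-topF inner ,
        outside-top inner c c′ e
          (outside-new ag (isSuc ∘ [ _ , suc ∘ κ ]) (outside-cong O′ (isSuc-widen ∘ Peak.κ K′)))
          λ j s → incomparable-colours {P = P} {Q} {inside} {none} pr (Outside.pt O i) (Outside.out O i) refl
            (Outside.pt O′ j) (trans (sym r) s))

-- Options against a list of colours

Chosen : {N : ℕ} → (Fin N → Set) → ℕ → Set
Chosen {N} Ψ k = Σ (Fin k → Fin N) λ f → (∀ {i j} → f i ≡ f j → i ≡ j) × (∀ i → Ψ (f i))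

module _ {N k : ℕ} (Ψ : Fin (1 + N) → Set) where

  chosen-suc : Chosen (Ψ ∘ suc) k → Chosen Ψ k
  chosen-suc (f , inj , ψ) = suc ∘ f , inj ∘ suc-injective , ψ

  chosen-zero : Ψ zero → Chosen (Ψ ∘ suc) k → Chosen Ψ (1 + k)
  chosen-zero ψ₀ (f , inj , ψ) = f′ , inj′ , λ { zero → ψ₀ ; (suc i) → ψ i }
    where
    f′ : Fin (1 + k) → Fin (1 + N)
    f′ zero = zero
    f′ (suc i) = suc (f i)
    inj′ : ∀ {i j} → f′ i ≡ f′ j → i ≡ j
    inj′ {zero} {zero} _ = refl
    inj′ {suc i} {suc j} e = cong suc (inj (suc-injective e))

-- Every index lowers one of the two demands by one, so `u + t` indices suffice.
choose : ∀ N u t {Ψ : Fin N → Set} → (∀ i → Dec (Ψ i)) → u + t ≤ N → Chosen Ψ u ⊎ Chosen (¬_ ∘ Ψ) t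
choose N zero t dec le = inj₁ ((λ ()) , (λ { {()} }) , λ ())
choose N (suc u) zero dec le = inj₂ ((λ ()) , (λ { {()} }) , λ ())
choose (suc N) (suc u) (suc t) {Ψ} dec (s≤s le) with dec zero
... | yes ψ = map (chosen-zero Ψ ψ) (chosen-suc (¬_ ∘ Ψ)) (choose N u (suc t) (dec ∘ suc) le)
... | no ¬ψ =
  map (chosen-suc Ψ) (chosen-zero (¬_ ∘ Ψ) ¬ψ) (choose N (suc u) t (dec ∘ suc) (subst (_≤ N) (+-suc u t) le))

empty-slot : ∀ {w} {P : BRel 0} → Slot w w P
empty-slot {P = P} = record
  { realizer = record { LX = P ; LY = P ; linearX = lin ; linearY = lin ; meet = λ () }
  ; β = all ; cut = λ () ; κ = λ () ; cover = λ () ; ι = id ; ι-injective = id ; free = λ () }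
  where
  lin : Linear P
  lin = record { compare = λ () ; antisymmetric = λ () ; transitive = λ () }

pullback-slot : ∀ {A B : Set} {w c} {P : Relᵇ A} {f : B → A} → (∀ {a b} → f a ≡ f b → a ≡ b) →
  Slot w c P → Slot w c (P on f)
pullback-slot {f = f} inj S = record
  { realizer = pullback-realizer inj realizer ; β = β ∘ f ; cut = λ a b → cut (f a) (f b) ; κ = κ ∘ f
  ; cover = λ a b → cover (f a) (f b) ; ι = ι ; ι-injective = ι-injective ; free = free ∘ f }
  where open Slot S

-- Renumbers the chains so that a given one becomes the chain that `Gap` leaves out.
toZero : ∀ {m} → Fin (1 + m) → Fin (1 + m) → Fin (1 + m)
toZero e k with e ≟F k
... | yes _ = zero
... | no e≢k = suc (punchOut e≢k)

toZero-self : ∀ {m} (e : Fin (1 + m)) → toZero e e ≡ zero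
toZero-self e with e ≟F e
... | yes _ = refl
... | no e≢e = ⊥-elim (e≢e refl)

toZero-injective : ∀ {m} (e : Fin (1 + m)) {i j} → toZero e i ≡ toZero e j → i ≡ j
toZero-injective e {i} {j} q with e ≟F i | e ≟F j
... | yes p | yes p′ = trans (sym p) p′
... | no p | no p′ = punchOut-injective p p′ (suc-injective q)

-- A slot that leaves out the chain numbered zero.
Gap : {A : Set} → ℕ → Relᵇ A → Set
Gap m P = Σ (Slot (1 + m) m P) λ S → ∀ k → Slot.ι S k ≡ suc k

peak-gap : ∀ {A : Set} {m} {P : Relᵇ A} → Peak m P → Gap m P
peak-gap K = record
  { realizer = realizer ; β = inside ; cut = cut ; κ = κ ; cover = cover ; ι = suc
  ; ι-injective = suc-injective ; free = λ a k e → subst (T ∘ isSuc) (sym e) _ } , λ _ → refl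
  where open Peak K

module _ {A B : Set} {m a : ℕ} {P : Relᵇ A} {Q : Relᵇ B} (S : Slot (1 + m) (1 + a) P) (K : Peak a Q) where
  open Slot S
  private module K = Peak K

  -- For a failed option: the next slot is also incomparable to chain zero of `K`, so the chain
  -- `ι zero` is no longer available.
  shrink : Slot (1 + m) a (insert P Q β none)
  shrink = record
    { realizer = nestˣ realizer β cut K.realizer
    ; β = [ K.inside , β ]
    ; cut = insert-cut _ cut K.cut (λ _ _ p _ → p) (λ _ _ ¬p p → ⊥-elim (¬p p))
    ; κ = [ ι ∘ K.κ , κ ]
    ; cover = slot-cover S K.cover
    ; ι = ι ∘ suc
    ; ι-injective = suc-injective ∘ ι-injective
    ; free = λ { (inj₁ b) k e → subst (T ∘ isSuc) (sym (ι-injective e)) _ ; (inj₂ a) k e → free a (suc k) e } }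

  -- Only the chain of Q outside K stays incomparable to the slot.
  release : Gap m (insert P Q β none)
  release = record
    { realizer = nestʸ realizer β cut K.realizer
    ; β = [ K.inside , all ]
    ; cut = insert-cut _ (λ _ _ _ _ → _) K.cut (λ _ _ _ _ → _) (λ _ _ ¬p _ → ⊥-elim (¬p _))
    -- Chain zero of `K` lies on the chain `ι zero`; all other points are below the slot.
    ; κ = toZero (ι zero) ∘ [ ι ∘ K.κ , κ ]
    ; cover = λ x y e → slot-cover S K.cover x y (toZero-injective (ι zero) e)
    ; ι = suc
    ; ι-injective = suc-injective
    ; free = λ { (inj₁ b) k e → free-new (K.κ b) k e ; (inj₂ _) _ _ → _ } } , λ _ → refl
    where
    free-new : ∀ i k → toZero (ι zero) (ι i) ≡ suc k → T (isSuc i)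
    free-new zero k e with trans (sym (toZero-self (ι zero))) e
    ... | ()
    free-new (suc _) k e = _

Offered : ℕ → ℕ → (ℕ → Set) → Goal
Offered m t Φ P col = Σ (Gap m P) λ G → Outside (Slot.β (proj₁ G)) col Φ t

module _ {N : ℕ} (b : Fin N → ℕ) where

  Listed : ℕ → Set
  Listed x = Σ (Fin N) λ i → b i ≡ x

  listed? : ∀ x → Dec (Listed x)
  listed? x = any? λ i → b i ≟ x

  few-listed : ∀ {n k β col} → Outside {n} β col Listed k → k ≤ N
  few-listed O = injective⇒≤ {f = λ i → proj₁ (colour i)} λ {i} {j} e →
    distinct (trans (sym (proj₂ (colour i))) (trans (cong b e) (proj₂ (colour j))))
    where open Outside O

-- b lists N colours. Options are built one inside the other; each failing one uses 1 + u listed colours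
-- that the others do not use, so fewer than s options fail.
module _ {m N s u t : ℕ} (b : Fin N → ℕ) (few : N < s *ℕ (1 + u)) (large : s + ((1 + u) + t) ≤ 1 + m) where

  -- If too little width were left, `large` would give `s ≤ j` and hence `s * (1 + u) ≤ N`, against
  -- `few`.
  enough-room : ∀ c j → c + j ≡ 1 + m → j *ℕ (1 + u) ≤ N → (1 + u) + t ≤ c
  enough-room c j e le with (1 + u) + t ≤? c
  ... | yes p = p
  ... | no ¬p = ⊥-elim (<⇒≱ few (≤-trans (*-monoˡ-≤ (1 + u) s≤j) le))
    where
    s≤j : s ≤ j
    s≤j = +-cancelʳ-≤ c s j (≤-trans (+-monoʳ-≤ s (<⇒≤ (≰⇒> ¬p)))
      (≤-trans large (≤-reflexive (trans (sym e) (+-comm c j)))))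

  -- `j` counts the failed options. Each has cost one chain of room and blocked `1 + u` listed
  -- colours in the current slot.
  offer-from : ∀ c j {n} {P : BRel n} {col} (S : Slot (1 + m) c P) → c + j ≡ 1 + m →
    Outside (Slot.β S) col (Listed b) (j *ℕ (1 + u)) → Proper P col →
    Force (1 + m) (Offered m t (¬_ ∘ Listed b)) n P col
  offer-from c j S e O pr with enough-room c j e (few-listed b O)
  -- `room` rules out `c = 0`, and it lets `choose` work with the `1 + a` colours of the climb.
  offer-from (suc a) j {n} {P} {col} S e O pr | room = play P col β none
    (pullback-good (splitAt-injective _) ∘ slot-room S) next (climb a) pr
    where
    open Slot S
    next : ∀ {q} {Q : BRel q} {colQ c} → Climbed a Q colQ → Agree c colQ col →
      Proper (insertF P Q β none) c →
      Force (1 + m) (Offered m t (¬_ ∘ Listed b)) (q + n) (insertF P Q β none) c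
    next {q} {Q} {colQ} {c} (K , O′) ag pr′
      with choose _ (1 + u) t (λ i → listed? b (colQ (Outside.pt O′ i))) room
    ... | inj₁ (f , inj , ψ) = offer-from a (suc j) (pullback-slot (splitAt-injective q) (shrink S K))
      (trans (+-suc a j) e)
      -- The colours of the earlier options are blocked in the slot, so the new listed colours
      -- differ from them.
      (outside-++ (outside-new ag [ Peak.inside K , β ] (outside-sub O′ f inj ψ))
        (outside-old ag [ Peak.inside K , β ] O)
        λ i k r → incomparable-colours {P = P} {Q} {β} {none} pr′ (Outside.pt O k) (Outside.out O k) refl _ (sym r))
      pr′
    ... | inj₂ (f , inj , ψ) = done ((pullback-slot (splitAt-injective q) (proj₁ (release S K)) , proj₂ (release S K)) ,
      outside-new ag [ Peak.inside K , all ] (outside-sub O′ f inj ψ))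

  offer : ∀ {P : BRel 0} {col} → Force (1 + m) (Offered m t (¬_ ∘ Listed b)) 0 P col
  offer = offer-from (1 + m) 0 empty-slot (+-identityʳ _)
    (record { pt = λ () ; out = λ () ; distinct = λ { {()} } ; colour = λ () }) λ ()

-- Square roots and the number of unlisted colours

root : ℕ → ℕ
root zero = 1
root (suc k) with suc k <? root k *ℕ root k
... | yes _ = root k
... | no _ = suc (root k)

-- Together with `root-lower` this shows that `root k` is ⌊√k⌋ + 1.
root-upper : ∀ k → k < root k *ℕ root k
root-upper zero = s≤s z≤n
root-upper (suc k) with suc k <? root k *ℕ root k
... | yes p = p
... | no _ = ≤-trans (s≤s (root-upper k)) (*-mono-< (n<1+n (root k)) (n<1+n (root k)))

root-lower : ∀ k → Σ ℕ λ ρ → root k ≡ suc ρ × ρ *ℕ ρ ≤ k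
root-lower zero = 0 , refl , z≤n
root-lower (suc k) with suc k <? root k *ℕ root k
... | no p = root k , refl , ≮⇒≥ p
... | yes _ with root-lower k
... | ρ , e , le = ρ , e , ≤-trans le (n≤1+n k)

root-suc : ∀ k → root k ≤ root (suc k)
root-suc k with suc k <? root k *ℕ root k
... | yes _ = ≤-refl
... | no _ = n≤1+n (root k)

-- The value of `t` when `s` and `1 + u` both equal `root (1 + m)`, truncated at 0.
spare : ℕ → ℕ
spare m = 1 + m ∸ (root (1 + m) + root (1 + m))

offer-spare : ∀ m (b : Fin (1 + m) → ℕ) {P : BRel 0} {col} →
  Force (1 + m) (Offered m (spare m) (¬_ ∘ Listed b)) 0 P col
offer-spare m b with root-lower (1 + m) | root-upper (1 + m) | root (1 + m) + root (1 + m) ≤? 1 + m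
... | ρ , e , _ | up | yes le = offer {s = r} {u = ρ} b (subst (λ x → 1 + m < r *ℕ x) e up)
  (≤-reflexive (trans (cong (λ x → r + (x + spare m)) (sym e))
    (trans (sym (+-assoc r r (spare m))) (m+[n∸m]≡n le))))
  where
  r : ℕ
  r = root (1 + m)
-- Here `spare m` is 0, so any gap will do and one climb supplies it.
... | _ | _ | no ¬le = bind id
  (λ { _ (K , O) → done (peak-gap K , outside-sub O (⊥-elim ∘ none-left) (λ {i} → ⊥-elim (none-left i)) (⊥-elim ∘ none-left)) })
  (λ ()) (climb m)
  where
  none-left : ¬ Fin (spare m)
  none-left i with subst Fin (m≤n⇒m∸n≡0 (<⇒≤ (≰⇒> ¬le))) i
  ... | ()

-- A place between an upper and a lower part

module _ {A : Set} {m : ℕ} {P : Relᵇ A} (K : Peak m (flip P)) where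
  open Peak K

  -- Reversal makes the place first in Y, and `swapᴿ` makes it first in X, so only Y cuts the upper
  -- part. A gap of the lower part is last in Y and cut only in X; one place therefore serves both.
  upper-realizer : Realizer P
  upper-realizer = swapᴿ (flipᴿ realizer)

  upper-cover : Cover P κ
  upper-cover a b e = swap (cover a b e)

  module _ {B : Set} {V : Relᵇ B} where

    below-realizer : Realizer V → Realizer (insert P V none all)
    below-realizer σ = insert-realizer upper-realizer σ none none (λ _ _ _ ()) (λ _ _ _ ()) (λ _ → refl) (λ _ → refl)

    below-cover : {κ′ : B → Fin (1 + m)} → Cover V κ′ → Cover (insert P V none all) [ κ′ , κ ]
    below-cover cov = insert-cover upper-cover cov λ _ _ _ → inj₂ _

    below-room : Good (1 + m) V → Good (1 + m) (insert P V none all)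
    below-room (σ , κ′ , cov) = below-realizer σ , _ , below-cover cov

    module _ (G : Gap m V) where
      private module G = Slot (proj₁ G)

      gapLo gapHi : B ⊎ A → Bool
      gapLo = [ G.β , none ]
      gapHi = [ none , inside ]

      -- The points incomparable to the place are those outside `G` or outside `K`, all on chain
      -- zero, so the chains `suc k` are free for Q.
      gap-room : ∀ {C D : Set} {Q : Relᵇ C} {f : D → B ⊎ A} → (∀ {x y} → f x ≡ f y → x ≡ y) →
        Good m Q → Good (1 + m) (insert (insert P V none all on f) Q (gapLo ∘ f) (gapHi ∘ f))
      gap-room {f = f} inj (σ , κ′ , cov) =
        insert-realizer (pullback-realizer inj (below-realizer G.realizer)) σ (βX ∘ f) (βY ∘ f)
          (λ x y → cutX (f x) (f y)) (λ x y → cutY (f x) (f y)) (elo ∘ f) (ehi ∘ f) ,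
        _ , insert-cover (λ x y → below-cover G.cover (f x) (f y)) (λ a b e → cov a b (suc-injective e))
          λ x c → between (f x) (κ′ c)
        where
        βX βY : B ⊎ A → Bool
        βX = [ G.β , none ]
        βY = [ all , not ∘ inside ]
        cutX : Cut (LX (below-realizer G.realizer)) βX
        cutX = insert-cut βX (λ _ _ _ ()) G.cut (λ _ _ ()) (λ _ _ _ ())
        cutY : Cut (LY (below-realizer G.realizer)) βY
        cutY = insert-cut βY (λ a b p q → T-not λ r → T-not⁻¹ q (cut b a p r)) (λ _ _ _ _ → _)
          (λ _ _ ()) (λ _ _ _ _ → _)
        elo : ∀ x → gapLo x ≡ βX x ∧ βY x
        elo (inj₁ b) = sym (∧-identityʳ (G.β b))
        elo (inj₂ a) = refl
        ehi : ∀ x → gapHi x ≡ not (βX x) ∧ not (βY x)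
        ehi (inj₁ b) = sym (∧-zeroʳ (not (G.β b)))
        ehi (inj₂ a) = sym (not-involutive (inside a))
        between : ∀ x k → [ G.κ , κ ] x ≡ suc k → T (gapLo x) ⊎ T (gapHi x)
        between (inj₁ b) k e = inj₁ (G.free b k (trans e (sym (proj₂ G k))))
        between (inj₂ a) k e = inj₂ (subst (T ∘ isSuc) (sym e) _)

-- Recursion on the width

forced : ℕ → ℕ
forced zero = 0
forced (suc m) = forced m + (spare m + (1 + m))

main : ∀ w {P : BRel 0} {col} → Force w (λ _ c → UsesAtLeast c (forced w)) 0 P col
main zero = done ((λ ()) , λ ())
main (suc m) = bind id upper (λ ()) (dual (climb m))
  where
  Won : Goal
  Won _ c = UsesAtLeast c (forced (1 + m))
  upper : ∀ {n} {P : BRel n} {col} → Proper P col → Climbed m (flip P) col → Force (1 + m) Won n P col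
  upper {n} {P} {col} pr (K , O) =
    -- The colours `b` are known before the lower part is built, so the lower part can be chosen
    -- against them.
    play P col none all (pullback-good (splitAt-injective _) ∘ below-room K) lower (offer-spare m b) pr
    where
    b : Fin (1 + m) → ℕ
    b i = col (Outside.pt O i)
    lower : ∀ {v} {V : BRel v} {colV c} → Offered m (spare m) (¬_ ∘ Listed b) V colV → Agree c colV col →
      Proper (insertF P V none all) c → Force (1 + m) Won (v + n) (insertF P V none all) c
    lower {v} {V} {colV} {c} (G , O′) ag pr′ =
      play W c lo hi (pullback-good (splitAt-injective _) ∘ gap-room K G (splitAt-injective v)) final (main m) pr′
      where
      open Agree ag
      W : BRel (v + n)
      W = insertF P V none all
      lo hi : Fin (v + n) → Bool
      lo = gapLo K G ∘ splitAt v
      hi = gapHi K G ∘ splitAt v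
      δ : Fin v ⊎ Fin n → Bool
      δ x = gapLo K G x ∨ gapHi K G x
      blocked : Outside (δ ∘ splitAt v) c AnyColour (spare m + (1 + m))
      blocked = outside-++
        (outside-anyColour (outside-new ag δ (outside-cong O′ λ x → ∨-identityʳ (Slot.β (proj₁ G) x))))
        (outside-old ag δ O)
        -- The lower part is below the whole upper part, so colours may recur in general; the
        -- offered ones do not, since they are not listed in `b`.
        λ i j e → Outside.colour O′ i (j , sym (trans (sym (new _)) (trans e (old _))))
      final : ∀ {q} {Q : BRel q} {colQ c′} → UsesAtLeast colQ (forced m) → Agree c′ colQ c →
        Proper (insertF W Q lo hi) c′ → Force (1 + m) Won (q + (v + n)) (insertF W Q lo hi) c′
      final {q} {Q} {colQ} {c′} (g , inj) ag′ pr″ = done (pts ∘ splitAt (forced m) , λ i j e →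
        ++-distinct {f = c′ ∘ (_↑ˡ (v + n)) ∘ g} {g = c′ ∘ (q ↑ʳ_) ∘ pt}
          (λ e′ → inj _ _ (trans (sym (Agree.new ag′ _)) (trans e′ (Agree.new ag′ _))))
          (λ e′ → distinct (trans (sym (Agree.old ag′ _)) (trans e′ (Agree.old ag′ _))))
          (λ k l e′ → incomparable-colours {P = W} {Q} {lo} {hi} pr″ (pt l)
            (∨-falseˡ (out l)) (∨-falseʳ {lo (pt l)} (out l)) (g k) (sym e′))
          (trans (sym (col-pts (splitAt (forced m) i))) (trans e (col-pts (splitAt (forced m) j)))))
        where
        open Outside blocked
        pts : Fin (forced m) ⊎ Fin (spare m + (1 + m)) → Fin (q + (v + n))
        pts = [ (_↑ˡ (v + n)) ∘ g , (q ↑ʳ_) ∘ pt ]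
        col-pts : ∀ x → c′ (pts x) ≡ [ c′ ∘ (_↑ˡ (v + n)) ∘ g , c′ ∘ (q ↑ʳ_) ∘ pt ] x
        col-pts (inj₁ x) = refl
        col-pts (inj₂ y) = refl
        ∨-falseˡ : ∀ {x y} → x ∨ y ≡ false → x ≡ false
        ∨-falseˡ {false} _ = refl
        ∨-falseʳ : ∀ {x y} → x ∨ y ≡ false → y ≡ false
        ∨-falseʳ {false} e = e

-- Back to the game of the theorem

T-∧⁺ : ∀ {x y} → T x → T y → T (x ∧ y)
T-∧⁺ p q = Equivalence.from T-∧ (p , q)

T-∧⁻ : ∀ {x y} → T (x ∧ y) → T x × T y
T-∧⁻ = Equivalence.to T-∧

module _ {n : ℕ} {P : BRel n} (ρ : Realizer P) where

  private
    both : ∀ {x y} → T (P x y) → T (LX ρ x y) × T (LY ρ x y)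
    both {x} {y} p = T-∧⁻ (subst T (meet ρ x y) p)
    unboth : ∀ {x y} → T (LX ρ x y) → T (LY ρ x y) → T (P x y)
    unboth {x} {y} p q = subst T (sym (meet ρ x y)) (T-∧⁺ p q)
    linear-refl : ∀ {L : BRel n} → Linear L → ∀ x → T (L x x)
    linear-refl l x = [ id , id ] (compare l x x)
    linear-poset : ∀ {L : BRel n} → Linear L → IsPoset L
    linear-poset l = record { reflexive = linear-refl l ; antisym = antisymmetric l ; transitive = transitive l }

  realizer-poset : IsPoset P
  realizer-poset = record
    { reflexive = λ x → unboth (linear-refl (linearX ρ) x) (linear-refl (linearY ρ) x)
    ; antisym = λ x y p q → antisymmetric (linearX ρ) x y (proj₁ (both p)) (proj₁ (both q))
    ; transitive = λ x y z p q →
        unboth (transitive (linearX ρ) x y z (proj₁ (both p)) (proj₁ (both q)))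
               (transitive (linearY ρ) x y z (proj₂ (both p)) (proj₂ (both q))) }

  realizer-dim : ∀ d → DimAtMost P (2 + d)
  realizer-dim d = L , ext , λ x y all′ → unboth (all′ zero) (all′ (suc zero))
    where
    L : Fin (2 + d) → BRel n
    L zero = LX ρ
    -- Repeating one order brings the family to size `2 + d` with the same intersection.
    L (suc _) = LY ρ
    ext : ∀ k → IsLinearExtension P (L k)
    ext zero = record { isPoset = linear-poset (linearX ρ) ; total = compare (linearX ρ)
                      ; extends = λ _ _ → proj₁ ∘ both }
    ext (suc _) = record { isPoset = linear-poset (linearY ρ) ; total = compare (linearY ρ)
                         ; extends = λ _ _ → proj₂ ∘ both }

cover-width : ∀ {n w} {P : BRel n} {κ : Fin n → Fin w} → Cover P κ → WidthAtMost P w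
cover-width {κ = κ} cov m a anti = injective⇒≤ {f = κ ∘ a} inj
  where
  inj : ∀ {i j} → κ (a i) ≡ κ (a j) → i ≡ j
  inj {i} {j} e with i ≟F j
  ... | yes p = p
  ... | no i≢j = ⊥-elim (anti i j i≢j (cov (a i) (a j) e))

force-wins : ∀ {w k n} d {P : BRel n} {col} → Proper P col → Force w (λ _ c → UsesAtLeast c k) n P col →
  AnnaWins w (2 + d) k n P col
force-wins d pr (done u) = done u
force-wins {n = n} d {col = col} pr (move P′ ext (ρ , κ , cov) next) =
  move P′ (realizer-poset ρ) ext (cover-width cov) (realizer-dim ρ d) λ c legal →
    let pr′ = proper′ c legal in force-wins d pr′ (next (extendCol c col) (λ _ → refl) pr′)
  where
  proper′ : ∀ c → (∀ x → col x ≡ c → Comp P′ zero (suc x)) → Proper P′ (extendCol c col)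
  proper′ c legal zero zero _ = inj₁ (IsPoset.reflexive (realizer-poset ρ) zero)
  proper′ c legal zero (suc y) e = legal y (sym e)
  proper′ c legal (suc x) zero e = swap (legal x e)
  proper′ c legal (suc x) (suc y) e rewrite ext x y | ext y x = pr x y e

-- Counting the forced colours

choose-two : ∀ w → 2 *ℕ ((w + 1) C 2) ≡ w *ℕ suc w
choose-two zero = refl
choose-two (suc w) = begin-equality
  2 *ℕ ((suc w + 1) C 2)                    ≡⟨ cong (2 *ℕ_) (nCk+nC[k+1]≡[n+1]C[k+1] (w + 1) 1) ⟨
  2 *ℕ ((w + 1) C 1 + (w + 1) C 2)          ≡⟨ *-distribˡ-+ 2 ((w + 1) C 1) _ ⟩
  2 *ℕ ((w + 1) C 1) + 2 *ℕ ((w + 1) C 2)   ≡⟨ cong₂ (λ x y → 2 *ℕ x + y) (nC1≡n (w + 1)) (choose-two w) ⟩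
  2 *ℕ (w + 1) + w *ℕ suc w                 ≡⟨ ring w ⟩
  suc w *ℕ suc (suc w)                      ∎
  where
  open ≤-Reasoning
  ring : ∀ w → 2 *ℕ (w + 1) + w *ℕ suc w ≡ suc w *ℕ suc (suc w)
  ring = solve-∀

-- The step to width `1 + m` loses at most `2 * root (1 + m)` against `2 * (1 + m)`, and `root` is
-- monotone.
forced-bound : ∀ w → w *ℕ suc w ≤ forced w + 2 *ℕ w *ℕ root w
forced-bound zero = z≤n
forced-bound (suc m) = begin
  suc m *ℕ suc (suc m)                                          ≡⟨ ring₁ m ⟩
  m *ℕ suc m + ((1 + m) + (1 + m))                              ≤⟨ +-mono-≤ (forced-bound m) (+-monoˡ-≤ (1 + m) (m≤n+m∸n (1 + m) (r + r))) ⟩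
  forced m + 2 *ℕ m *ℕ root m + (r + r + spare m + (1 + m))     ≤⟨ +-monoˡ-≤ _ (+-monoʳ-≤ (forced m) (*-monoʳ-≤ (2 *ℕ m) (root-suc m))) ⟩
  forced m + 2 *ℕ m *ℕ r + (r + r + spare m + (1 + m))          ≡⟨ ring₂ (forced m) m r (spare m) ⟩
  forced (suc m) + 2 *ℕ suc m *ℕ r                              ∎
  where
  open ≤-Reasoning
  r : ℕ
  r = root (suc m)
  ring₁ : ∀ m → suc m *ℕ suc (suc m) ≡ m *ℕ suc m + ((1 + m) + (1 + m))
  ring₁ = solve-∀
  ring₂ : ∀ F m r s → F + 2 *ℕ m *ℕ r + (r + r + s + (1 + m)) ≡ F + (s + (1 + m)) + 2 *ℕ suc m *ℕ r
  ring₂ = solve-∀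

-- The loss `2 * w * root w` divided by the binomial coefficient w(w + 1)/2.
deficit : ℕ → ℚ
deficit w = ℤ.+ (4 *ℕ root w) / suc w

-- The inequality (2 - 4r/(w+1)) T ≤ F with the denominator cleared and no subtraction.
cleared-bound : ∀ w → 2 *ℕ suc w *ℕ ((w + 1) C 2) ≤ forced w *ℕ suc w + 4 *ℕ root w *ℕ ((w + 1) C 2)
cleared-bound w = begin
  2 *ℕ suc w *ℕ t                                   ≡⟨ ring₁ (suc w) t ⟩
  2 *ℕ t *ℕ suc w                                   ≡⟨ cong (_*ℕ suc w) (choose-two w) ⟩
  w *ℕ suc w *ℕ suc w                               ≤⟨ *-monoˡ-≤ (suc w) (forced-bound w) ⟩
  (forced w + 2 *ℕ w *ℕ root w) *ℕ suc w            ≡⟨ ring₂ (forced w) w (root w) (suc w) ⟩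
  forced w *ℕ suc w + 2 *ℕ root w *ℕ (w *ℕ suc w)   ≡⟨ cong (λ x → forced w *ℕ suc w + 2 *ℕ root w *ℕ x) (choose-two w) ⟨
  forced w *ℕ suc w + 2 *ℕ root w *ℕ (2 *ℕ t)       ≡⟨ ring₃ (forced w *ℕ suc w) (root w) t ⟩
  forced w *ℕ suc w + 4 *ℕ root w *ℕ t              ∎
  where
  open ≤-Reasoning
  t : ℕ
  t = (w + 1) C 2
  ring₁ : ∀ a t → 2 *ℕ a *ℕ t ≡ 2 *ℕ t *ℕ a
  ring₁ = solve-∀
  ring₂ : ∀ F w r a → (F + 2 *ℕ w *ℕ r) *ℕ a ≡ F *ℕ a + 2 *ℕ r *ℕ (w *ℕ a)
  ring₂ = solve-∀
  ring₃ : ∀ x r t → x + 2 *ℕ r *ℕ (2 *ℕ t) ≡ x + 4 *ℕ r *ℕ t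
  ring₃ = solve-∀

fraction-bound : ∀ a r t F → 2 *ℕ suc a *ℕ t ≤ F *ℕ suc a + r *ℕ t →
  (ℕtoℚ 2 - ℤ.+ r / suc a) * ℕtoℚ t ≤ℚ ℕtoℚ F
fraction-bound a r t F le = toℚᵘ-cancel-≤
  (ℚᵘ.≤-respˡ-≃ (ℚᵘ.≃-sym lhs) (ℚᵘ.≤-respʳ-≃ (ℚᵘ.≃-sym (toℚᵘ-fromℚᵘ (mkℚᵘ (ℤ.+ F) 0))) (*≤* bound)))
  where
  lhs : toℚᵘ ((ℕtoℚ 2 - ℤ.+ r / suc a) * ℕtoℚ t) ≃
    (mkℚᵘ (ℤ.+ 2) 0 ℚᵘ.- mkℚᵘ (ℤ.+ r) a) ℚᵘ.* mkℚᵘ (ℤ.+ t) 0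
  lhs = ℚᵘ.≃-trans (toℚᵘ-homo-* (ℕtoℚ 2 - ℤ.+ r / suc a) (ℕtoℚ t)) (ℚᵘ.*-cong
    (ℚᵘ.≃-trans (toℚᵘ-homo-+ (ℕtoℚ 2) (ℚ.- (ℤ.+ r / suc a))) (ℚᵘ.+-cong (toℚᵘ-fromℚᵘ (mkℚᵘ (ℤ.+ 2) 0))
      (ℚᵘ.≃-trans (toℚᵘ-homo‿- (ℤ.+ r / suc a)) (ℚᵘ.-‿cong (toℚᵘ-fromℚᵘ (mkℚᵘ (ℤ.+ r) a))))))
    (toℚᵘ-fromℚᵘ (mkℚᵘ (ℤ.+ t) 0)))
  ring : ∀ a r t → ((ℤ.+ 2 ℤ.* a) ℤ.+ (ℤ.- r ℤ.* ℤ.+ 1)) ℤ.* t ℤ.* ℤ.+ 1 ≡ ℤ.+ 2 ℤ.* a ℤ.* t ℤ.- r ℤ.* t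
  ring = ℤ-solve-∀
  cancel : ∀ x y → x ℤ.+ y ℤ.- y ≡ x
  cancel = ℤ-solve-∀
  bound : ((ℤ.+ 2 ℤ.* ℤ.+ suc a) ℤ.+ (ℤ.- (ℤ.+ r) ℤ.* ℤ.+ 1)) ℤ.* ℤ.+ t ℤ.* ℤ.+ 1 ℤ.≤
    ℤ.+ F ℤ.* ℤ.+ (1 *ℕ suc a *ℕ 1)
  bound = begin
    ((ℤ.+ 2 ℤ.* ℤ.+ suc a) ℤ.+ (ℤ.- (ℤ.+ r) ℤ.* ℤ.+ 1)) ℤ.* ℤ.+ t ℤ.* ℤ.+ 1
      ≡⟨ ring (ℤ.+ suc a) (ℤ.+ r) (ℤ.+ t) ⟩
    ℤ.+ 2 ℤ.* ℤ.+ suc a ℤ.* ℤ.+ t ℤ.- ℤ.+ r ℤ.* ℤ.+ t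
      ≡⟨ cong₂ ℤ._-_ (sym (ℤ.pos-* (2 *ℕ suc a) t)) (sym (ℤ.pos-* r t)) ⟩
    ℤ.+ (2 *ℕ suc a *ℕ t) ℤ.- ℤ.+ (r *ℕ t)
      ≤⟨ ℤ.+-monoˡ-≤ (ℤ.- ℤ.+ (r *ℕ t)) (ℤ.+≤+ le) ⟩
    ℤ.+ (F *ℕ suc a) ℤ.+ ℤ.+ (r *ℕ t) ℤ.- ℤ.+ (r *ℕ t)
      ≡⟨ cancel (ℤ.+ (F *ℕ suc a)) (ℤ.+ (r *ℕ t)) ⟩
    ℤ.+ (F *ℕ suc a)
      ≡⟨ cong (λ x → ℤ.+ (F *ℕ x)) (sym (trans (*-identityʳ (1 *ℕ suc a)) (+-identityʳ (suc a)))) ⟩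
    ℤ.+ (F *ℕ (1 *ℕ suc a *ℕ 1))
      ≡⟨ ℤ.pos-* F _ ⟩
    ℤ.+ F ℤ.* ℤ.+ (1 *ℕ suc a *ℕ 1) ∎
    where open ℤ.≤-Reasoning

-- With `root w` = ρ + 1, the size of w forces 8q ≤ ρ, and then 4(ρ + 1)q ≤ 8qρ ≤ ρ² ≤ w.
root-small : ∀ q w → (1 + 8 *ℕ q) *ℕ (1 + 8 *ℕ q) ≤ w → 1 ≤ q → 4 *ℕ root w *ℕ q ≤ suc w
root-small q w large 1≤q with root-lower w | root-upper w
... | ρ , e , ρ²≤w | w<r² rewrite e = begin
  4 *ℕ suc ρ *ℕ q               ≡⟨ ring₁ ρ q ⟩
  4 *ℕ q *ℕ ρ + 4 *ℕ q *ℕ 1     ≤⟨ +-monoʳ-≤ (4 *ℕ q *ℕ ρ) (*-monoʳ-≤ (4 *ℕ q) 1≤ρ) ⟩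
  4 *ℕ q *ℕ ρ + 4 *ℕ q *ℕ ρ     ≡⟨ ring₂ q ρ ⟩
  8 *ℕ q *ℕ ρ                   ≤⟨ *-monoˡ-≤ ρ 8q≤ρ ⟩
  ρ *ℕ ρ                        ≤⟨ ρ²≤w ⟩
  w                             ≤⟨ n≤1+n w ⟩
  suc w                         ∎
  where
  open ≤-Reasoning
  8q≤ρ : 8 *ℕ q ≤ ρ
  8q≤ρ with 8 *ℕ q ≤? ρ
  ... | yes p = p
  ... | no ¬p = ⊥-elim (<⇒≱ w<r² (≤-trans (*-mono-≤ r≤ r≤) large))
    where
    r≤ : suc ρ ≤ 1 + 8 *ℕ q
    r≤ = ≤-trans (≰⇒> ¬p) (n≤1+n _)
  1≤ρ : 1 ≤ ρ
  1≤ρ = ≤-trans (≤-trans 1≤q (m≤n*m q 8)) 8q≤ρ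
  ring₁ : ∀ ρ q → 4 *ℕ suc ρ *ℕ q ≡ 4 *ℕ q *ℕ ρ + 4 *ℕ q *ℕ 1
  ring₁ = solve-∀
  ring₂ : ∀ q ρ → 4 *ℕ q *ℕ ρ + 4 *ℕ q *ℕ ρ ≡ 8 *ℕ q *ℕ ρ
  ring₂ = solve-∀

deficit-vanishes : ∀ ε → 0ℚ <ℚ ε → Σ ℕ λ W → ∀ w → W ≤ w → ∣ deficit w ∣ ≤ℚ ε
deficit-vanishes ε ε>0 with positive ε>0
-- A positive ε is at least 1/(d + 1), so `root-small` applies with q = d + 1; the threshold is (1 +
-- 8q)², read off from `bound`.
deficit-vanishes (mkℚ (ℤ.+ suc p) d coprime) ε>0 | _ = _ , λ w large →
  subst (_≤ℚ mkℚ (ℤ.+ suc p) d coprime) (sym (0≤p⇒∣p∣≡p (nonNegative⁻¹ (deficit w) {{normalize-nonNeg (4 *ℕ root w) (suc w)}})))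
    (toℚᵘ-cancel-≤ (ℚᵘ.≤-respˡ-≃ (ℚᵘ.≃-sym (toℚᵘ-fromℚᵘ (mkℚᵘ (ℤ.+ (4 *ℕ root w)) w))) (*≤* (bound w large))))
  where
  bound : ∀ w → (1 + 8 *ℕ suc d) *ℕ (1 + 8 *ℕ suc d) ≤ w →
    ℤ.+ (4 *ℕ root w) ℤ.* ℤ.+ suc d ℤ.≤ ℤ.+ suc p ℤ.* ℤ.+ suc w
  bound w large = begin
    ℤ.+ (4 *ℕ root w) ℤ.* ℤ.+ suc d   ≡⟨ ℤ.pos-* (4 *ℕ root w) (suc d) ⟨
    ℤ.+ (4 *ℕ root w *ℕ suc d)        ≤⟨ ℤ.+≤+ (≤-trans (root-small (suc d) w large (s≤s z≤n)) (m≤n*m (suc w) (suc p))) ⟩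
    ℤ.+ (suc p *ℕ suc w)              ≡⟨ ℤ.pos-* (suc p) (suc w) ⟩
    ℤ.+ suc p ℤ.* ℤ.+ suc w           ∎
    where open ℤ.≤-Reasoning

theorem1p1 : Σ (ℕ → ℚ) λ f →
    (∀ (ε : ℚ) → 0ℚ <ℚ ε → Σ ℕ λ W → ∀ w → W ≤ w → ∣ f w ∣ ≤ℚ ε) ×
    (∀ (w d : ℕ) → 1 ≤ w → 2 ≤ d →
      Σ ℕ λ k → ((ℕtoℚ 2 - f w) * ℕtoℚ ((w + 1) C 2) ≤ℚ ℕtoℚ k) × AnnaForces w d k)
theorem1p1 = deficit , deficit-vanishes , λ { w (suc (suc d)) _ (s≤s (s≤s _)) →
  forced w , fraction-bound w (4 *ℕ root w) ((w + 1) C 2) (forced w) (cleared-bound w) ,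
  force-wins d (λ ()) (main w) }
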